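{- Let $\phi$ be a CNF formula over a finite set $X$ of Boolean variables, let $(T, r, \gamma, \pi)$ be a project-join tree of $\phi$, and let $W = \prod_{x \in X} W_x$ be a literal-weight function over $X$. Then the $W$-valuation of the root satisfies $f^W_r(\emptyset) = W(\phi)$, where $W(\phi)$ is the weighted model count of $\phi$ with respect to $W$.
   Context: Truth assignments to a set $X$ of Boolean variables are identified with subsets $\tau \in 2^X$ (the variables set to true). A pseudo-Boolean function over $X$ is a function $f : 2^X \to \mathbb{R}$. Product: for $f : 2^X \to \mathbb{R}$ and $g : 2^Y \to \mathbb{R}$, $f \cdot g : 2^{X \cup Y} \to \mathbb{R}$ is $(f\cdot g)(\tau) = f(\tau \cap X)\, g(\tau \cap Y)$. The empty product is the constant $1$ on $2^\emptyset$. Projection: for $f : 2^X \to \mathbb{R}$ and $x \in X$, $\sum_x f : 2^{X \setminus \{x\}} \to \mathbb{R}$ is $(\sum_x f)(\tau) = f(\tau) + f(\tau \cup \{x\})$. Projections commute; for $Y=\{x_1,\dots,x_k\}\subseteq X$, $\sum_Y f = \sum_{x_1} \cdots \sum_{x_k} f$, and $\sum_\emptyset f = f$. A CNF formula $\phi$ over $X$ is a finite set of clauses; each clause $c$ has a set of variables $\mathrm{vars}(c) \subseteq X$ and is identified with the function $2^{\mathrm{vars}(c)} \to \{0,1\}$ with value $1$ exactly on assignments satisfying $c$. $\phi$ is identified with the Boolean function $\prod_{c \in \phi} c$ (viewed as a function on $2^X$, ignoring variables not occurring in it). A literal-weight function over $X$ is $W = \prod_{x \in X} W_x : 2^X \to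 \mathbb{R}$ with $W_x : 2^{\{x\}} \to \mathbb{R}$ for each $x$. The weighted model count is $W(\phi) = \sum_{\tau \in 2^X} \phi(\tau) W(\tau)$. A project-join tree of $\phi$ is a tuple $(T, r, \gamma, \pi)$ where $T$ is a finite tree with root $r$, $\mathcal{V}(T)$ is its node set, $\mathcal{L}(T)$ its set of leaves (nodes with no children), $\gamma : \mathcal{L}(T) \to \phi$ is a bijection, and $\pi : \mathcal{V}(T) \setminus \mathcal{L}(T) \to 2^X$ labels internal nodes, such that: (1) the sets $\pi(n)$, $n$ ranging over internal nodes, form a partition of $X$ (pairwise disjoint for distinct nodes, with union $X$; some may be empty); (2) for each internal node $n$, each $x \in \pi(n)$, and each clause $c \in \phi$ in which $x$ appears, the leaf $\gamma^{ -1}(c)$ is a descendant of $n$. $\mathcal{C}(n)$ denotes the set of children of $n$. The $W$-valuation $f^W_n$ of a node $n$ is defined recursively: $f^W_n = \gamma(n)$ if $n$ is a leaf, and $f^W_n = \sum_{\pi(n)} \left( \prod_{o \in \mathcal{C}(n)} f^W_o \cdot \prod_{x \in \pi(n)} W_x \right)$ if $n$ is internal. -}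

module Defs where

open import Algebra.Bundles using (CommutativeRing)
open import Data.Bool.Base using (if_then_else_)
open import Data.Fin.Base using (Fin)
open import Data.Fin.Properties using (any?)
open import Data.Fin.Subset
  using (Subset; inside; outside; _∈_; _∉_; _⊆_; ⊥; ⁅_⁆; _∩_; _∪_; _-_; Empty)
open import Data.Fin.Subset.Properties
  using (_∈?_; ⊆-min; ⊆-trans; p∩q⊆q; p⊆p∪q; q⊆p∪q; p─q⊆p; x∈p∪q⁻; x∈⁅x⁆; x∈⁅y⁆⇒x≡y;
         x∈p∧x≢y⇒x∈p-y)
open import Data.Irrelevant using ([_])
open import Data.List.Base as List using (List; []; _∷_; _++_; foldr; filter; allFin; tabulate)
import Data.List.Membership.Propositional as List∈
open import Data.List.Membership.Propositional.Properties using (∈-filter⁺; ∈-allFin)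
open import Data.List.Relation.Unary.All as All using (All; []; _∷_)
open import Data.List.Relation.Unary.All.Properties using (all-filter)
open import Data.List.Relation.Unary.AllPairs using ([]; _∷_)
open import Data.List.Relation.Unary.Any using (here; there)
open import Data.List.Relation.Unary.Unique.Propositional using (Unique)
open import Data.List.Relation.Unary.Unique.Propositional.Properties using (allFin⁺; filter⁺)
open import Data.Nat.Base using (ℕ; zero; suc)
open import Data.Product.Base using (_×_; ∃; _,_; proj₁)
open import Data.Refinement using (Refinement-syntax; _,_; value)
open import Data.Sum.Base using (_⊎_; [_,_]′)
open import Data.Vec.Base using ([]; _∷_)
open import Function.Base using (_∘_)
open import Function.Bundles using (_↔_; Inverse)
open import Relation.Binary.PropositionalEquality using (_≡_; _≢_; refl; sym)
open import Relation.Nullary.Decidable using (Dec; does; _×-dec_; _⊎-dec_; ¬?)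

-- The finite set X of Boolean variables is Fin n throughout.

-- 2^ Y is the set of truth assignments to Y ⊆ X.  The inclusion proof is
-- irrelevant, so assignments with the same underlying subset are equal.
2^_ : ∀ {n} → Subset n → Set
2^_ {n} Y = [ τ ∈ Subset n ∣ τ ⊆ Y ]

∅ : ∀ {n} {Y : Subset n} → 2^ Y
∅ {Y = Y} = ⊥ , [ ⊆-min Y ]

restrict : ∀ {n} → Subset n → (Y : Subset n) → 2^ Y
restrict τ Y = τ ∩ Y , [ p∩q⊆q τ Y ]

allSubsets : ∀ n → List (Subset n)
allSubsets zero    = [] ∷ []
allSubsets (suc n) =
  List.map (outside ∷_) (allSubsets n) ++ List.map (inside ∷_) (allSubsets n)

module _ {n : ℕ} where

  elements : Subset n → List (Fin n)
  elements Y = filter (_∈? Y) (allFin n)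

  elements-unique : (Y : Subset n) → Unique (elements Y)
  elements-unique Y = filter⁺ (_∈? Y) (allFin⁺ n)

  elements-sound : (Y : Subset n) → All (_∈ Y) (elements Y)
  elements-sound Y = all-filter (_∈? Y) (allFin n)

  elements-complete : ∀ {x} (Y : Subset n) → x ∈ Y → x List∈.∈ elements Y
  elements-complete {x} Y x∈Y = ∈-filter⁺ (_∈? Y) (∈-allFin x) x∈Y

-- A clause is a set of literals, given by the set of variables that occur
-- positively and the set of those that occur negatively.
record Clause (n : ℕ) : Set where
  field
    pos neg : Subset n

  vars : Subset n
  vars = pos ∪ neg

open Clause public

module _ {n : ℕ} where

  Satisfies : Subset n → Clause n → Set
  Satisfies τ c = ∃ λ x → (x ∈ pos c × x ∈ τ) ⊎ (x ∈ neg c × x ∉ τ)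

  satisfies? : ∀ τ c → Dec (Satisfies τ c)
  satisfies? τ c = any? λ x →
    ((x ∈? pos c) ×-dec (x ∈? τ)) ⊎-dec ((x ∈? neg c) ×-dec ¬? (x ∈? τ))

record CNF (n : ℕ) : Set where
  field
    clauses  : List (Clause n)
    distinct : Unique clauses

  ClauseOf : Set
  ClauseOf = ∃ λ c → c List∈.∈ clauses

open CNF public using (clauses; ClauseOf)

-- Finite rooted trees.  Internal nodes have at least one child, so the leaves
-- are exactly the nodes without children.
data Tree : Set where
  leaf : Tree
  node : (k : ℕ) → (Fin (suc k) → Tree) → Tree

data Leaf : Tree → Set where
  root  : Leaf leaf
  below : ∀ {k ts} (i : Fin (suc k)) → Leaf (ts i) → Leaf (node k ts)

data Internal : Tree → Set where
  root  : ∀ {k ts} → Internal (node k ts)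
  below : ∀ {k ts} (i : Fin (suc k)) → Internal (ts i) → Internal (node k ts)

data _DescendantOf_ : ∀ {T} → Leaf T → Internal T → Set where
  root  : ∀ {k ts} {l : Leaf (node k ts)} → l DescendantOf root
  below : ∀ {k ts} {i : Fin (suc k)} {l : Leaf (ts i)} {m : Internal (ts i)} →
          l DescendantOf m → _DescendantOf_ {node k ts} (below i l) (below i m)

record ProjectJoinTree {n : ℕ} (φ : CNF n) : Set where
  field
    T : Tree
    γ : Leaf T ↔ ClauseOf φ
    π : Internal T → Subset n

    π-disjoint : ∀ {m m′} → m ≢ m′ → Empty (π m ∩ π m′)
    π-covers   : ∀ x → ∃ λ m → x ∈ π m
    π-below    : ∀ m {x} → x ∈ π m → (c : ClauseOf φ) → x ∈ vars (proj₁ c) →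
                 Inverse.from γ c DescendantOf m

-- The ring R stands for the reals; only its commutative ring structure is used.
module PseudoBoolean {a ℓ} (R : CommutativeRing a ℓ) {n : ℕ} where

  open CommutativeRing R using (Carrier; _+_; _*_; 0#; 1#)

  record PBFunction : Set a where
    constructor pbf
    field
      dom : Subset n
      fun : 2^ dom → Carrier

  open PBFunction public

  -- The value of f at an assignment to all of X, ignoring variables outside
  -- the domain of f.
  _at_ : PBFunction → Subset n → Carrier
  f at τ = fun f (restrict τ (dom f))

  infixl 7 _·_
  _·_ : PBFunction → PBFunction → PBFunction
  f · g = pbf (dom f ∪ dom g) λ τ → (f at value τ) * (g at value τ)

  𝟙 : PBFunction
  𝟙 = pbf ⊥ λ _ → 1#

  ∏ : List PBFunction → PBFunction
  ∏ = foldr _·_ 𝟙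

  project : (x : Fin n) (f : PBFunction) → .(x ∈ dom f) → PBFunction
  project x (pbf Y f) x∈Y = pbf (Y - x) λ
    { (τ , [ τ⊆ ]) →
        f (τ , [ ⊆-trans τ⊆ (p─q⊆p Y ⁅ x ⁆) ])
        + f (τ ∪ ⁅ x ⁆ , [ ∪-⊆ (⊆-trans τ⊆ (p─q⊆p Y ⁅ x ⁆)) x∈Y ]) }
    where
    ∪-⊆ : ∀ {τ} → τ ⊆ Y → x ∈ Y → τ ∪ ⁅ x ⁆ ⊆ Y
    ∪-⊆ {τ} τ⊆Y x∈Y y∈ =
      [ τ⊆Y , (λ y∈⁅x⁆ → ≡⇒∈ (x∈⁅y⁆⇒x≡y x y∈⁅x⁆)) ]′ (x∈p∪q⁻ τ ⁅ x ⁆ y∈)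
      where
      ≡⇒∈ : ∀ {y} → y ≡ x → y ∈ Y
      ≡⇒∈ refl = x∈Y

  -- Projections commute, so the order in which variables are projected is
  -- immaterial.
  projectList : (xs : List (Fin n)) (f : PBFunction) →
                Unique xs → All (_∈ dom f) xs → PBFunction
  projectList []       f []         []         = f
  projectList (x ∷ xs) f (x∉ ∷ uxs) (x∈ ∷ xs∈) =
    projectList xs (project x f x∈) uxs
      (All.zipWith (λ { (y∈ , x≢y) → x∈p∧x≢y⇒x∈p-y y∈ (x≢y ∘ sym) }) (xs∈ , x∉))

  ∑ : (Y : Subset n) (f : PBFunction) → Y ⊆ dom f → PBFunction
  ∑ Y f Y⊆ = projectList (elements Y) f (elements-unique Y)
               (All.map (λ x∈ → Y⊆ x∈) (elements-sound Y))

  clauseFunction : Clause n → PBFunction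
  clauseFunction c = pbf (vars c) λ τ →
    if does (satisfies? (value τ) c) then 1# else 0#

  cnfFunction : CNF n → PBFunction
  cnfFunction φ = ∏ (List.map clauseFunction (clauses φ))

  LiteralWeights : Set a
  LiteralWeights = (x : Fin n) → 2^ ⁅ x ⁆ → Carrier

  module _ (W : LiteralWeights) where

    weight : Fin n → PBFunction
    weight x = pbf ⁅ x ⁆ (W x)

    weightFunction : PBFunction
    weightFunction = ∏ (List.map weight (allFin n))

    weightedModelCount : CNF n → Carrier
    weightedModelCount φ =
      foldr _+_ 0# (List.map (λ τ → (cnfFunction φ at τ) * (weightFunction at τ))
                             (allSubsets n))

    ∏weight : Subset n → PBFunction
    ∏weight Y = ∏ (List.map weight (elements Y))

    ⊆-∏weight : ∀ Y → Y ⊆ dom (∏weight Y)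
    ⊆-∏weight Y x∈Y = go (elements-complete Y x∈Y)
      where
      go : ∀ {x xs} → x List∈.∈ xs → x ∈ dom (∏ (List.map weight xs))
      go (here refl) = p⊆p∪q _ (x∈⁅x⁆ _)
      go (there x∈)  = q⊆p∪q _ _ (go x∈)

    -- The W-valuation of the root of T, where T carries the leaf labels γ and
    -- the internal-node labels π.  The valuation of any other node is that of
    -- the root of the subtree below it, with the labels inherited from T.
    valuation : (T : Tree) → (Leaf T → Clause n) → (Internal T → Subset n) → PBFunction
    valuation leaf        γ π = clauseFunction (γ root)
    valuation (node k ts) γ π =
      ∑ (π root) (children · ∏weight (π root))
        (⊆-trans (⊆-∏weight (π root)) (q⊆p∪q (dom children) (dom (∏weight (π root)))))
      where
      children : PBFunction
      children = ∏ (tabulate λ i →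
        valuation (ts i) (λ l → γ (below i l)) (λ m → π (below i m)))

    rootValuation : {φ : CNF n} → ProjectJoinTree φ → PBFunction
    rootValuation P = valuation T (λ l → proj₁ (Inverse.to γ l)) π
      where open ProjectJoinTree P

-- Every variable is projected at exactly one internal node, and every factor
-- that mentions it (a clause, or its weight) sits below that node.  By the
-- distributive law a product of sums over sibling subtrees is one sum over
-- their joint variables, because no factor of one subtree mentions a variable
-- projected in another.  By induction the valuation of a subtree is therefore
-- the sum, over the variables projected in it, of the product of all its
-- factors; at the root this is the sum over all of X of φ · W.
module Submission where

open import Defs
open import Algebra.Bundles using (CommutativeRing; CommutativeMonoid)
import Algebra.Properties.CommutativeSemigroup as CommutativeSemigroupProperties
open import Data.Bool.Base using (_∧_; _∨_)
open import Data.Bool.Properties using (∧-zeroʳ; ∨-identityʳ)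
open import Data.Fin.Base using (Fin; zero; suc)
open import Data.Fin.Properties using (_≟_; suc-injective)
open import Data.Fin.Subset
  using (Subset; inside; outside; _∈_; _∉_; _⊆_; ⊥; ⁅_⁆; _∩_; _∪_; _-_)
open import Data.Fin.Subset.Properties
  using (∩-assoc; ∩-zeroˡ; ∪-identityʳ; p─⊥≡p; p∩q⊆q; x∈p∩q⁺; ⊆-antisym;
         p⊆p∪q; q⊆p∪q; x∈⁅y⁆⇒x≡y)
open import Data.List.Base as List
  using (List; []; _∷_; _++_; concat; foldr; allFin; tabulate)
open import Data.List.Membership.Propositional using () renaming (_∈_ to _∈ˡ_)
open import Data.List.Membership.Propositional.Properties
  using (∈-allFin; ∈-concat⁺′; ∈-concat⁻′; ∈-tabulate⁺; ∈-tabulate⁻;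
         ∈-++⁺ˡ; ∈-++⁺ʳ; ∈-++⁻; ∈-map⁻)
open import Data.List.Membership.Propositional.Properties.WithK
  using (unique∧set⇒bag; unique⇒irrelevant)
open import Data.List.Properties using (concat-map; map-tabulate; map-++; map-∘; foldr-++)
open import Data.List.Relation.Binary.BagAndSetEquality using (∼bag⇒↭)
open import Data.List.Relation.Binary.Disjoint.Propositional using (Disjoint)
open import Data.List.Relation.Binary.Permutation.Propositional
  using (_↭_; ↭-refl; ↭-trans; module PermutationReasoning)
  renaming (refl to refl↭; prep to prep↭; swap to swap↭; trans to trans↭)
open import Data.List.Relation.Binary.Permutation.Propositional.Properties
  using (map⁺; ++⁺; ++⁺ˡ; ++⁺ʳ; ++-assoc; ++-comm; ++-commutativeMonoid)
open import Data.List.Relation.Unary.All as All using (All; []; _∷_)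
import Data.List.Relation.Unary.All.Properties as All
open import Data.List.Relation.Unary.AllPairs using ([]; _∷_)
import Data.List.Relation.Unary.AllPairs.Properties as AllPairs
open import Data.List.Relation.Unary.Any using (here; there)
open import Data.List.Relation.Unary.Unique.Propositional using (Unique)
import Data.List.Relation.Unary.Unique.Propositional.Properties as Unique
open import Data.Nat.Base using (ℕ; zero; suc)
open import Data.Product.Base using (∃; _,_; proj₁; proj₂)
open import Data.Refinement using (value-injective)
open import Data.Sum.Base using (_⊎_; inj₁; inj₂)
open import Data.Vec.Base using ([]; _∷_; here; there; _[_]≔_)
open import Data.Vec.Properties using ([]≔-commutes; []≔-idempotent)
open import Function.Base using (_∘_)
open import Function.Bundles using (Inverse; mk⇔)
open import Relation.Binary.PropositionalEquality
  using (_≡_; _≢_; refl; sym; trans; cong; cong₂; subst)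
open import Relation.Nullary.Decidable using (yes; no)
open import Relation.Nullary.Negation using (contradiction)

-- Restricting and updating assignments.

∩-∩-⊆ : ∀ {n} (τ : Subset n) {D Y : Subset n} → Y ⊆ D → (τ ∩ D) ∩ Y ≡ τ ∩ Y
∩-∩-⊆ τ {D} {Y} Y⊆D = trans (∩-assoc τ D Y)
  (cong (τ ∩_) (⊆-antisym (p∩q⊆q D Y) λ x∈Y → x∈p∩q⁺ (Y⊆D x∈Y , x∈Y)))

∩-≔-∉ : ∀ {n} (τ : Subset n) {x b} (Y : Subset n) → x ∉ Y → (τ [ x ]≔ b) ∩ Y ≡ τ ∩ Y
∩-≔-∉ (t ∷ τ) {zero} {b} (outside ∷ Y) _ = cong (_∷ τ ∩ Y) (trans (∧-zeroʳ b) (sym (∧-zeroʳ t)))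
∩-≔-∉ (t ∷ τ) {zero} (inside ∷ Y) x∉ = contradiction here x∉
∩-≔-∉ (t ∷ τ) {suc x} (y ∷ Y) x∉ = cong (t ∧ y ∷_) (∩-≔-∉ τ Y (x∉ ∘ there))

-- The first summand of `project` sees `x` as false: removing `x` from the mask clears the same bit
-- as setting `x` to `outside`.
∩-minus : ∀ {n} (τ Y : Subset n) x → τ ∩ (Y - x) ≡ (τ [ x ]≔ outside) ∩ Y
∩-minus (t ∷ τ) (y ∷ Y) zero = cong₂ _∷_ (∧-zeroʳ t) (cong (τ ∩_) (p─⊥≡p Y))
∩-minus (t ∷ τ) (y ∷ Y) (suc x) = cong (t ∧ y ∷_) (∩-minus τ Y x)

-- This serves the second summand of `project`. Membership of `x` in `Y` keeps the updated bit
-- visible after the restriction on the right.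
∩-minus-∪ : ∀ {n} (τ : Subset n) {Y : Subset n} {x} → x ∈ Y →
            (τ ∩ (Y - x)) ∪ ⁅ x ⁆ ≡ (τ [ x ]≔ inside) ∩ Y
∩-minus-∪ (t ∷ τ) {inside ∷ Y} here = cong₂ _∷_
  (cong (_∨ inside) (∧-zeroʳ t))
  (trans (∪-identityʳ _) (cong (τ ∩_) (p─⊥≡p Y)))
∩-minus-∪ (t ∷ τ) {y ∷ Y} (there x∈Y) = cong₂ _∷_ (∨-identityʳ (t ∧ y)) (∩-minus-∪ τ x∈Y)

∈-elements⁻ : ∀ {n} (Y : Subset n) {x} → x ∈ˡ elements Y → x ∈ Y
∈-elements⁻ Y = All.lookup (elements-sound Y)

-- Membership in a duplicate-free list has at most one proof, so agreeing as sets means agreeing as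
-- bags, that is, up to permutation.
unique-same⇒↭ : ∀ {a} {A : Set a} {xs ys : List A} → Unique xs → Unique ys →
                (∀ {x} → x ∈ˡ xs → x ∈ˡ ys) → (∀ {x} → x ∈ˡ ys → x ∈ˡ xs) → xs ↭ ys
unique-same⇒↭ uxs uys to from = ∼bag⇒↭ (unique∧set⇒bag uxs uys (mk⇔ to from))

-- Lists collected over the children of a node.

gather : ∀ {a} {A : Set a} {k} → (Fin k → List A) → List A
gather f = concat (tabulate f)

module _ {a} {A : Set a} where

  ∈-gather⁺ : ∀ {k} (f : Fin k → List A) i {x} → x ∈ˡ f i → x ∈ˡ gather f
  ∈-gather⁺ f i x∈ = ∈-concat⁺′ x∈ (∈-tabulate⁺ i)

  ∈-gather⁻ : ∀ {k} (f : Fin k → List A) {x} → x ∈ˡ gather f → ∃ λ i → x ∈ˡ f i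
  ∈-gather⁻ f x∈ with ∈-concat⁻′ (tabulate f) x∈
  ... | _ , x∈xs , xs∈ with ∈-tabulate⁻ xs∈
  ...   | i , refl = i , x∈xs

  gather-unique : ∀ {k} {f : Fin k → List A} → (∀ i → Unique (f i)) →
                  (∀ {i j} → i ≢ j → Disjoint (f i) (f j)) → Unique (gather f)
  gather-unique u d = Unique.concat⁺ (All.tabulate⁺ u) (AllPairs.tabulate⁺ d)

  gather-↭ : ∀ {k} {f g : Fin k → List A} → (∀ i → f i ↭ g i) → gather f ↭ gather g
  gather-↭ {zero}  f↭g = ↭-refl
  gather-↭ {suc k} f↭g = ++⁺ (f↭g zero) (gather-↭ (f↭g ∘ suc))

  gather-++ : ∀ {k} (f g : Fin k → List A) →
              gather (λ i → f i ++ g i) ↭ gather f ++ gather g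
  gather-++ {zero}  f g = ↭-refl
  gather-++ {suc k} f g = ↭-trans
    (++⁺ˡ (f zero ++ g zero) (gather-++ (f ∘ suc) (g ∘ suc)))
    (interchange (f zero) (g zero) (gather (f ∘ suc)) (gather (g ∘ suc)))
    where
    open CommutativeSemigroupProperties
      (CommutativeMonoid.commutativeSemigroup (++-commutativeMonoid {A = A}))

  gather-map : ∀ {b} {B : Set b} (h : A → B) {k} (f : Fin k → List A) →
               gather (List.map h ∘ f) ≡ List.map h (gather f)
  gather-map h f = trans (cong concat (sym (map-tabulate f (List.map h)))) (concat-map (tabulate f))

-- Leaf labels and projected variables of a tree.

internal-below-injective : ∀ {k ts i} {m m′ : Internal (ts i)} →
                           Internal.below {k} {ts} i m ≡ below i m′ → m ≡ m′
internal-below-injective refl = refl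

leaf-below-injective : ∀ {k ts i} {l l′ : Leaf (ts i)} →
                       Leaf.below {k} {ts} i l ≡ below i l′ → l ≡ l′
leaf-below-injective refl = refl

internal-below-≢ : ∀ {k ts i j} {m : Internal (ts i)} {m′ : Internal (ts j)} → i ≢ j →
                   Internal.below {k} {ts} i m ≢ below j m′
internal-below-≢ i≢j refl = i≢j refl

leaf-below-≢ : ∀ {k ts i j} {l : Leaf (ts i)} {l′ : Leaf (ts j)} → i ≢ j →
               Leaf.below {k} {ts} i l ≢ below j l′
leaf-below-≢ i≢j refl = i≢j refl

module _ {a} {A : Set a} where

  leafLabels : (T : Tree) → (Leaf T → A) → List A
  leafLabels leaf        γ = γ root ∷ []
  leafLabels (node k ts) γ = gather λ i → leafLabels (ts i) (γ ∘ below i)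

  ∈-leafLabels⁺ : ∀ {T} {γ : Leaf T → A} l → γ l ∈ˡ leafLabels T γ
  ∈-leafLabels⁺ root        = here refl
  ∈-leafLabels⁺ {node k ts} {γ} (below i l) =
    ∈-gather⁺ (λ i → leafLabels (ts i) (γ ∘ below i)) i (∈-leafLabels⁺ l)

  ∈-leafLabels⁻ : ∀ T {γ : Leaf T → A} {x} → x ∈ˡ leafLabels T γ → ∃ λ l → x ≡ γ l
  ∈-leafLabels⁻ leaf        (here x≡) = root , x≡
  ∈-leafLabels⁻ (node k ts) {γ} x∈ with ∈-gather⁻ (λ i → leafLabels (ts i) (γ ∘ below i)) x∈
  ... | i , x∈i with ∈-leafLabels⁻ (ts i) x∈i
  ...   | l , x≡ = below i l , x≡

  leafLabels-unique : ∀ T {γ : Leaf T → A} → (∀ {l l′} → γ l ≡ γ l′ → l ≡ l′) →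
                      Unique (leafLabels T γ)
  leafLabels-unique leaf        inj = [] ∷ []
  leafLabels-unique (node k ts) {γ} inj = gather-unique
    (λ i → leafLabels-unique (ts i) (leaf-below-injective ∘ inj)) disj
    where
    disj : ∀ {i j} → i ≢ j →
           Disjoint (leafLabels (ts i) (γ ∘ below i)) (leafLabels (ts j) (γ ∘ below j))
    disj {i} {j} i≢j (x∈i , x∈j)
      with ∈-leafLabels⁻ (ts i) x∈i | ∈-leafLabels⁻ (ts j) x∈j
    ... | _ , x≡ | _ , x≡′ = leaf-below-≢ i≢j (inj (trans (sym x≡) x≡′))

module _ {n : ℕ} where

  -- The label of the root comes first so that `foldr` makes its sums the outermost ones, as in
  -- `valuation`.
  projectedVars : (T : Tree) → (Internal T → Subset n) → List (Fin n)
  projectedVars leaf        π = []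
  projectedVars (node k ts) π =
    elements (π root) ++ gather λ i → projectedVars (ts i) (π ∘ below i)

  ∈-projectedVars⁺ : ∀ {T} {π : Internal T → Subset n} m {x} → x ∈ π m → x ∈ˡ projectedVars T π
  ∈-projectedVars⁺ {π = π} root x∈ = ∈-++⁺ˡ (elements-complete (π root) x∈)
  ∈-projectedVars⁺ {node k ts} {π} (below i m) x∈ = ∈-++⁺ʳ (elements (π root))
    (∈-gather⁺ (λ i → projectedVars (ts i) (π ∘ below i)) i
      (∈-projectedVars⁺ {π = π ∘ below i} m x∈))

  ∈-projectedVars⁻ : ∀ T {π : Internal T → Subset n} {x} → x ∈ˡ projectedVars T π → ∃ λ m → x ∈ π m
  ∈-projectedVars⁻ (node k ts) {π} x∈ with ∈-++⁻ (elements (π root)) x∈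
  ... | inj₁ x∈root = root , ∈-elements⁻ (π root) x∈root
  ... | inj₂ x∈below with ∈-gather⁻ (λ i → projectedVars (ts i) (π ∘ below i)) x∈below
  ...   | i , x∈i with ∈-projectedVars⁻ (ts i) x∈i
  ...     | m , x∈m = below i m , x∈m

  -- The part of the partition condition that restricts to subtrees, whose labels in general no
  -- longer cover all variables.
  DisjointLabels : ∀ {T} → (Internal T → Subset n) → Set
  DisjointLabels π = ∀ {m m′ x} → m ≢ m′ → x ∈ π m → x ∉ π m′

  below-disjoint : ∀ {k ts} {π : Internal (node k ts) → Subset n} → DisjointLabels π →
                   ∀ i → DisjointLabels (π ∘ below i)
  below-disjoint d i m≢m′ = d (m≢m′ ∘ internal-below-injective)

  projectedVars-unique : ∀ T {π : Internal T → Subset n} → DisjointLabels π →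
                         Unique (projectedVars T π)
  projectedVars-unique leaf        d = []
  projectedVars-unique (node k ts) {π} d = Unique.++⁺ (elements-unique (π root))
    (gather-unique (λ i → projectedVars-unique (ts i) (below-disjoint {π = π} d i)) siblings)
    root-below
    where
    siblings : ∀ {i j} → i ≢ j →
               Disjoint (projectedVars (ts i) (π ∘ below i)) (projectedVars (ts j) (π ∘ below j))
    siblings {i} {j} i≢j (x∈i , x∈j)
      with ∈-projectedVars⁻ (ts i) x∈i | ∈-projectedVars⁻ (ts j) x∈j
    ... | _ , x∈m | _ , x∈m′ = d (internal-below-≢ i≢j) x∈m x∈m′

    root-below : Disjoint (elements (π root)) (gather λ i → projectedVars (ts i) (π ∘ below i))
    root-below (x∈root , x∈below)
      with ∈-gather⁻ (λ i → projectedVars (ts i) (π ∘ below i)) x∈below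
    ... | i , x∈i with ∈-projectedVars⁻ (ts i) x∈i
    ...   | _ , x∈m = d (λ ()) (∈-elements⁻ (π root) x∈root) x∈m

-- Iterated sums over Boolean variables.

module Summation {a ℓ} (R : CommutativeRing a ℓ) where

  open CommutativeRing R
    using (Carrier; _≈_; _+_; _*_; 0#; setoid; +-cong; *-cong; *-comm; +-assoc;
           +-identityˡ; +-identityʳ; distribˡ; +-commutativeSemigroup)
    renaming (refl to ≈-refl; sym to ≈-sym; trans to ≈-trans; reflexive to ≈-reflexive)
  open CommutativeSemigroupProperties +-commutativeSemigroup using ()
    renaming (interchange to +-interchange)
  open import Relation.Binary.Reasoning.Setoid setoid

  -- Projection acting on functions of total assignments. The domain stays fixed, and independence
  -- of `x` replaces its removal from the domain.
  sumOut : ∀ {n} → Fin n → (Subset n → Carrier) → Subset n → Carrier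
  sumOut x F τ = F (τ [ x ]≔ outside) + F (τ [ x ]≔ inside)

  sumOver : ∀ {n} → List (Fin n) → (Subset n → Carrier) → Subset n → Carrier
  sumOver xs F = foldr sumOut F xs

  module _ {n : ℕ} where

    infix 4 _≋_
    _≋_ : (F G : Subset n → Carrier) → Set ℓ
    F ≋ G = ∀ τ → F τ ≈ G τ

    sumOut-cong : ∀ x {F G} → F ≋ G → sumOut x F ≋ sumOut x G
    sumOut-cong x F≋G τ = +-cong (F≋G _) (F≋G _)

    sumOver-cong : ∀ xs {F G} → F ≋ G → sumOver xs F ≋ sumOver xs G
    sumOver-cong []       F≋G = F≋G
    sumOver-cong (x ∷ xs) F≋G = sumOut-cong x (sumOver-cong xs F≋G)

    sumOut-comm : ∀ x y F → sumOut x (sumOut y F) ≋ sumOut y (sumOut x F)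
    sumOut-comm x y F τ with x ≟ y
    ... | yes refl = ≈-refl
    ... | no x≢y = begin
      (F (τ [ x ]≔ outside [ y ]≔ outside) + F (τ [ x ]≔ outside [ y ]≔ inside))
        + (F (τ [ x ]≔ inside [ y ]≔ outside) + F (τ [ x ]≔ inside [ y ]≔ inside))
        ≈⟨ +-interchange _ _ _ _ ⟩
      (F (τ [ x ]≔ outside [ y ]≔ outside) + F (τ [ x ]≔ inside [ y ]≔ outside))
        + (F (τ [ x ]≔ outside [ y ]≔ inside) + F (τ [ x ]≔ inside [ y ]≔ inside))
        ≡⟨ cong₂ _+_ (cong₂ _+_ swap swap) (cong₂ _+_ swap swap) ⟩
      (F (τ [ y ]≔ outside [ x ]≔ outside) + F (τ [ y ]≔ outside [ x ]≔ inside))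
        + (F (τ [ y ]≔ inside [ x ]≔ outside) + F (τ [ y ]≔ inside [ x ]≔ inside)) ∎
      where
      swap : ∀ {b c} → F (τ [ x ]≔ b [ y ]≔ c) ≡ F (τ [ y ]≔ c [ x ]≔ b)
      swap = cong F ([]≔-commutes τ x y x≢y)

    -- `projectList` applies the head of its list first, hence innermost, while `sumOver` has it
    -- outermost; this reconciles the two orders.
    sumOver-sumOut : ∀ x xs F → sumOver xs (sumOut x F) ≋ sumOut x (sumOver xs F)
    sumOver-sumOut x []       F τ = ≈-refl
    sumOver-sumOut x (y ∷ xs) F τ = ≈-trans
      (sumOut-cong y (sumOver-sumOut x xs F) τ) (sumOut-comm y x (sumOver xs F) τ)

    sumOver-↭ : ∀ {xs ys} F → xs ↭ ys → sumOver xs F ≋ sumOver ys F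
    sumOver-↭ F refl↭          τ = ≈-refl
    sumOver-↭ F (prep↭ x p)    τ = sumOut-cong x (sumOver-↭ F p) τ
    sumOver-↭ F (swap↭ {ys = ys} x y p) τ = ≈-trans
      (sumOut-cong x (sumOut-cong y (sumOver-↭ F p)) τ) (sumOut-comm x y (sumOver ys F) τ)
    sumOver-↭ F (trans↭ p q)   τ = ≈-trans (sumOver-↭ F p τ) (sumOver-↭ F q τ)

    -- Semantic counterpart of `x` lying outside the domain. It survives products and sums, so
    -- domains of compound functions need not be computed.
    _Ignores_ : (Subset n → Carrier) → Fin n → Set ℓ
    F Ignores x = ∀ b τ → F (τ [ x ]≔ b) ≈ F τ

    sumOut-ignores : ∀ {F} x y → F Ignores x → sumOut y F Ignores x
    sumOut-ignores {F} x y F-ignores b τ with x ≟ y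
    -- The sum over `x` overwrites the value at `x`, so an earlier update there is lost.
    ... | yes refl = ≈-reflexive
      (cong₂ _+_ (cong F ([]≔-idempotent τ x)) (cong F ([]≔-idempotent τ x)))
    ... | no x≢y = +-cong ignore ignore
      where
      ignore : ∀ {c} → F (τ [ x ]≔ b [ y ]≔ c) ≈ F (τ [ y ]≔ c)
      ignore = ≈-trans (≈-reflexive (cong F ([]≔-commutes τ x y x≢y))) (F-ignores b _)

    sumOver-ignores : ∀ {F x} xs → F Ignores x → sumOver xs F Ignores x
    sumOver-ignores []       F-ignores = F-ignores
    sumOver-ignores (y ∷ xs) F-ignores = sumOut-ignores _ y (sumOver-ignores xs F-ignores)

    -- The distributive law, one variable at a time: since `F` ignores the variables being summed,
    -- `F τ` equals its value at every updated assignment and moves under the sum.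
    *-sumOver : ∀ {F} xs G → (∀ {x} → x ∈ˡ xs → F Ignores x) →
                ∀ τ → F τ * sumOver xs G τ ≈ sumOver xs (λ σ → F σ * G σ) τ
    *-sumOver []       G F-ignores τ = ≈-refl
    *-sumOver {F} (x ∷ xs) G F-ignores τ = begin
      F τ * (S (τ [ x ]≔ outside) + S (τ [ x ]≔ inside))
        ≈⟨ distribˡ _ _ _ ⟩
      F τ * S (τ [ x ]≔ outside) + F τ * S (τ [ x ]≔ inside)
        ≈⟨ +-cong step step ⟩
      sumOver (x ∷ xs) (λ σ → F σ * G σ) τ ∎
      where
      S = sumOver xs G
      step : ∀ {b} → F τ * S (τ [ x ]≔ b) ≈ sumOver xs (λ σ → F σ * G σ) (τ [ x ]≔ b)
      step {b} = ≈-trans (*-cong (≈-sym (F-ignores (here refl) b τ)) ≈-refl)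
                         (*-sumOver xs G (F-ignores ∘ there) _)

    sumOver-* : ∀ {F} xs G → (∀ {x} → x ∈ˡ xs → F Ignores x) →
                ∀ τ → sumOver xs G τ * F τ ≈ sumOver xs (λ σ → G σ * F σ) τ
    sumOver-* xs G F-ignores τ = ≈-trans (*-comm _ _)
      (≈-trans (*-sumOver xs G F-ignores τ) (sumOver-cong xs (λ _ → *-comm _ _) τ))

    -- First the whole second sum is carried under the first as a constant factor: it ignores each
    -- `x` in `xs` because `G` does. Then `F` moves under the inner sums, and nested sums
    -- concatenate.
    sumOver-product : ∀ {F G} xs ys →
      (∀ {y} → y ∈ˡ ys → F Ignores y) → (∀ {x} → x ∈ˡ xs → G Ignores x) →
      ∀ τ → sumOver xs F τ * sumOver ys G τ ≈ sumOver (xs ++ ys) (λ σ → F σ * G σ) τ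
    sumOver-product {F} {G} xs ys F-ignores G-ignores τ = begin
      sumOver xs F τ * sumOver ys G τ
        ≈⟨ sumOver-* xs F (sumOver-ignores ys ∘ G-ignores) τ ⟩
      sumOver xs (λ σ → F σ * sumOver ys G σ) τ
        ≈⟨ sumOver-cong xs (*-sumOver ys G F-ignores) τ ⟩
      sumOver xs (sumOver ys (λ σ → F σ * G σ)) τ
        ≡⟨ cong (λ H → H τ) (foldr-++ sumOut _ xs ys) ⟨
      sumOver (xs ++ ys) (λ σ → F σ * G σ) τ ∎

  sumOver-map-suc : ∀ {n} xs (F : Subset (suc n) → Carrier) b τ →
                    sumOver (List.map suc xs) F (b ∷ τ) ≡ sumOver xs (F ∘ (b ∷_)) τ
  sumOver-map-suc []       F b τ = refl
  sumOver-map-suc (x ∷ xs) F b τ =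
    cong₂ _+_ (sumOver-map-suc xs F b _) (sumOver-map-suc xs F b _)

  sum : List Carrier → Carrier
  sum = foldr _+_ 0#

  sum-++ : ∀ xs ys → sum (xs ++ ys) ≈ sum xs + sum ys
  sum-++ []       ys = ≈-sym (+-identityˡ _)
  sum-++ (x ∷ xs) ys = ≈-trans (+-cong ≈-refl (sum-++ xs ys)) (≈-sym (+-assoc _ _ _))

  -- Summing over all variables overwrites every bit, so the result does not depend on `τ`. The
  -- outermost sum, over the first variable, matches the two halves of `allSubsets`.
  sumOver-allFin : ∀ n (F : Subset n → Carrier) τ →
                   sumOver (allFin n) F τ ≈ sum (List.map F (allSubsets n))
  sumOver-allFin zero    F [] = ≈-sym (+-identityʳ _)
  sumOver-allFin (suc n) F (t ∷ τ) = begin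
    S (outside ∷ τ) + S (inside ∷ τ)
      ≈⟨ +-cong (half outside) (half inside) ⟩
    sum (extend outside) + sum (extend inside)
      ≈⟨ sum-++ (extend outside) (extend inside) ⟨
    sum (extend outside ++ extend inside)
      ≡⟨ cong sum (map-++ F (List.map (outside ∷_) (allSubsets n)) _) ⟨
    sum (List.map F (allSubsets (suc n))) ∎
    where
    S = sumOver (tabulate suc) F
    extend = λ b → List.map F (List.map (b ∷_) (allSubsets n))
    half : ∀ b → S (b ∷ τ) ≈ sum (extend b)
    half b = begin
      S (b ∷ τ)
        -- The tail of `allFin (suc n)` is `tabulate suc`, which must be recognised as the image of
        -- `allFin n`.
        ≡⟨ cong (λ xs → sumOver xs F (b ∷ τ)) (map-tabulate (λ i → i) suc) ⟨
      sumOver (List.map suc (allFin n)) F (b ∷ τ)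
        ≡⟨ sumOver-map-suc (allFin n) F b τ ⟩
      sumOver (allFin n) (F ∘ (b ∷_)) τ
        ≈⟨ sumOver-allFin n (F ∘ (b ∷_)) τ ⟩
      sum (List.map (F ∘ (b ∷_)) (allSubsets n))
        ≡⟨ cong sum (map-∘ (allSubsets n)) ⟩
      sum (extend b) ∎

-- The factors collected from a subtree.

module Factorisation {a ℓ} (R : CommutativeRing a ℓ) {n : ℕ}
                     (W : PseudoBoolean.LiteralWeights R {n}) where

  open PseudoBoolean R {n}

  factors : (T : Tree) → (Leaf T → Clause n) → (Internal T → Subset n) → List PBFunction
  factors leaf        γ π = clauseFunction (γ root) ∷ []
  factors (node k ts) γ π =
    gather (λ i → factors (ts i) (γ ∘ below i) (π ∘ below i))
      ++ List.map (weight W) (elements (π root))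

  ∈-weights⁻ : ∀ {Y f x} → f ∈ˡ List.map (weight W) (elements Y) → x ∈ dom f → x ∈ Y
  ∈-weights⁻ {Y} f∈ x∈ with ∈-map⁻ (weight W) f∈
  ... | y , y∈ , refl with x∈⁅y⁆⇒x≡y y x∈
  ...   | refl = ∈-elements⁻ Y y∈

  -- Distinguishes the two ways a factor can mention a variable: clauses are controlled by the
  -- descendant condition, weights by disjointness of the labels.
  factor-scope : ∀ T {γ π f x} → f ∈ˡ factors T γ π → x ∈ dom f →
                 (∃ λ l → x ∈ vars (γ l)) ⊎ (∃ λ m → x ∈ π m)
  factor-scope leaf (here refl) x∈ = inj₁ (root , x∈)
  factor-scope (node k ts) {γ} {π} f∈ x∈
    with ∈-++⁻ (gather λ i → factors (ts i) (γ ∘ below i) (π ∘ below i)) f∈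
  ... | inj₂ f∈root = inj₂ (root , ∈-weights⁻ f∈root x∈)
  ... | inj₁ f∈below
    with ∈-gather⁻ (λ i → factors (ts i) (γ ∘ below i) (π ∘ below i)) f∈below
  ...   | i , f∈i with factor-scope (ts i) f∈i x∈
  ...     | inj₁ (l , x∈l) = inj₁ (below i l , x∈l)
  ...     | inj₂ (m , x∈m) = inj₂ (below i m , x∈m)

  -- Separates the clauses from the weights, which are interleaved node by node in `factors`; at the
  -- root the two groups become the formula and the weight function.
  factors-↭ : ∀ T (γ : Leaf T → Clause n) (π : Internal T → Subset n) →
    factors T γ π ↭
      List.map clauseFunction (leafLabels T γ) ++ List.map (weight W) (projectedVars T π)
  factors-↭ leaf        γ π = ↭-refl
  factors-↭ (node k ts) γ π = begin
    gather (λ i → factors (ts i) (γ ∘ below i) (π ∘ below i)) ++ w (elements (π root))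
      ↭⟨ ++⁺ʳ _ (gather-↭ λ i → factors-↭ (ts i) (γ ∘ below i) (π ∘ below i)) ⟩
    gather (λ i → c (labels i) ++ w (xs i)) ++ w (elements (π root))
      ↭⟨ ++⁺ʳ _ (gather-++ (c ∘ labels) (w ∘ xs)) ⟩
    (gather (c ∘ labels) ++ gather (w ∘ xs)) ++ w (elements (π root))
      ↭⟨ ++-assoc (gather (c ∘ labels)) _ _ ⟩
    gather (c ∘ labels) ++ gather (w ∘ xs) ++ w (elements (π root))
      ↭⟨ ++⁺ˡ (gather (c ∘ labels)) (++-comm (gather (w ∘ xs)) _) ⟩
    gather (c ∘ labels) ++ w (elements (π root)) ++ gather (w ∘ xs)
      ≡⟨ cong₂ (λ cs ws → cs ++ w (elements (π root)) ++ ws)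
           (gather-map clauseFunction labels) (gather-map (weight W) xs) ⟩
    c (gather labels) ++ w (elements (π root)) ++ w (gather xs)
      ≡⟨ cong (c (gather labels) ++_) (map-++ (weight W) (elements (π root)) (gather xs)) ⟨
    c (gather labels) ++ w (elements (π root) ++ gather xs) ∎
    where
    open PermutationReasoning
    c = List.map clauseFunction
    w = List.map (weight W)
    labels = λ i → leafLabels (ts i) (γ ∘ below i)
    xs = λ i → projectedVars (ts i) (π ∘ below i)

-- Valuations as sums of products of factors.

module Evaluation {a ℓ} (R : CommutativeRing a ℓ) {n : ℕ} where

  open CommutativeRing R
    using (Carrier; _≈_; _+_; _*_; 1#; setoid; *-cong; *-congˡ; *-assoc;
           *-identityˡ; *-identityʳ; *-commutativeSemigroup)
    renaming (refl to ≈-refl; sym to ≈-sym; trans to ≈-trans; reflexive to ≈-reflexive)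
  open CommutativeSemigroupProperties *-commutativeSemigroup using (x∙yz≈y∙xz)
  open import Relation.Binary.Reasoning.Setoid setoid
  open Summation R
  open PseudoBoolean R {n}

  at-cong : ∀ f {σ τ} → σ ∩ dom f ≡ τ ∩ dom f → f at σ ≡ f at τ
  at-cong f eq = cong (fun f) (value-injective eq)

  at-ignores : ∀ f {x} → x ∉ dom f → (f at_) Ignores x
  at-ignores f x∉ b τ = ≈-reflexive (at-cong f (∩-≔-∉ τ (dom f) x∉))

  at-· : ∀ f g τ → (f · g) at τ ≡ f at τ * g at τ
  at-· f g τ = cong₂ _*_ (at-cong f (∩-∩-⊆ τ (p⊆p∪q (dom g))))
                        (at-cong g (∩-∩-⊆ τ (q⊆p∪q (dom f) (dom g))))

  at-project : ∀ f {x} (x∈ : x ∈ dom f) τ → project x f x∈ at τ ≡ sumOut x (f at_) τ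
  at-project f {x} x∈ τ = cong₂ _+_ (cong (fun f) (value-injective (∩-minus τ (dom f) x)))
                                    (cong (fun f) (value-injective (∩-minus-∪ τ x∈)))

  at-projectList : ∀ xs f (u : Unique xs) (xs∈ : All (_∈ dom f) xs) τ →
                   projectList xs f u xs∈ at τ ≈ sumOver xs (f at_) τ
  at-projectList []       f []       []         τ = ≈-refl
  at-projectList (x ∷ xs) f (x∉ ∷ u) (x∈ ∷ xs∈) τ = begin
    projectList (x ∷ xs) f (x∉ ∷ u) (x∈ ∷ xs∈) at τ
      ≈⟨ at-projectList xs (project x f x∈) u _ τ ⟩
    sumOver xs (project x f x∈ at_) τ
      ≈⟨ sumOver-cong xs (λ σ → ≈-reflexive (at-project f x∈ σ)) τ ⟩
    sumOver xs (sumOut x (f at_)) τ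
      ≈⟨ sumOver-sumOut x xs (f at_) τ ⟩
    sumOver (x ∷ xs) (f at_) τ ∎

  prodAt : List PBFunction → Subset n → Carrier
  prodAt fs τ = foldr _*_ 1# (List.map (_at τ) fs)

  at-∏ : ∀ fs τ → ∏ fs at τ ≡ prodAt fs τ
  at-∏ []       τ = refl
  at-∏ (f ∷ fs) τ = trans (at-· f (∏ fs) τ) (cong (f at τ *_) (at-∏ fs τ))

  prodAt-++ : ∀ fs gs τ → prodAt (fs ++ gs) τ ≈ prodAt fs τ * prodAt gs τ
  prodAt-++ []       gs τ = ≈-sym (*-identityˡ _)
  prodAt-++ (f ∷ fs) gs τ = ≈-trans (*-congˡ (prodAt-++ fs gs τ)) (≈-sym (*-assoc _ _ _))

  prodAt-↭ : ∀ {fs gs} → fs ↭ gs → ∀ τ → prodAt fs τ ≈ prodAt gs τ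
  prodAt-↭ refl↭         τ = ≈-refl
  prodAt-↭ (prep↭ f p)   τ = *-congˡ (prodAt-↭ p τ)
  prodAt-↭ (swap↭ f g p) τ = ≈-trans (x∙yz≈y∙xz _ _ _) (*-congˡ (*-congˡ (prodAt-↭ p τ)))
  prodAt-↭ (trans↭ p q)  τ = ≈-trans (prodAt-↭ p τ) (prodAt-↭ q τ)

  prodAt-ignores : ∀ fs {x} → (∀ {f} → f ∈ˡ fs → x ∉ dom f) → prodAt fs Ignores x
  prodAt-ignores []       x∉ b τ = ≈-refl
  prodAt-ignores (f ∷ fs) x∉ b τ =
    *-cong (at-ignores f (x∉ (here refl)) b τ) (prodAt-ignores fs (x∉ ∘ there) b τ)

  -- Induction over the children, splitting off the first. `sep` is applied in both directions: the
  -- factors of the first child ignore the variables of the others, and conversely, as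
  -- `sumOver-product` demands.
  prodAt-tabulate : ∀ {k} (V : Fin k → PBFunction) (xs : Fin k → List (Fin n))
    (fs : Fin k → List PBFunction) →
    (∀ i τ → V i at τ ≈ sumOver (xs i) (prodAt (fs i)) τ) →
    (∀ {i j x f} → i ≢ j → x ∈ˡ xs i → f ∈ˡ fs j → x ∉ dom f) →
    ∀ τ → prodAt (tabulate V) τ ≈ sumOver (gather xs) (prodAt (gather fs)) τ
  prodAt-tabulate {zero}  V xs fs V≈ sep τ = ≈-refl
  prodAt-tabulate {suc k} V xs fs V≈ sep τ = begin
    V zero at τ * prodAt (tabulate (V ∘ suc)) τ
      ≈⟨ *-cong (V≈ zero τ)
           (prodAt-tabulate (V ∘ suc) (xs ∘ suc) (fs ∘ suc) (V≈ ∘ suc)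
              (λ i≢j → sep (i≢j ∘ suc-injective)) τ) ⟩
    sumOver (xs zero) (prodAt (fs zero)) τ * sumOver xs₊ (prodAt fs₊) τ
      ≈⟨ sumOver-product (xs zero) xs₊ head-ignores tail-ignores τ ⟩
    sumOver (gather xs) (λ σ → prodAt (fs zero) σ * prodAt fs₊ σ) τ
      ≈⟨ sumOver-cong (gather xs) (prodAt-++ (fs zero) fs₊) τ ⟨
    sumOver (gather xs) (prodAt (gather fs)) τ ∎
    where
    xs₊ = gather (xs ∘ suc)
    fs₊ = gather (fs ∘ suc)
    head-ignores : ∀ {y} → y ∈ˡ xs₊ → prodAt (fs zero) Ignores y
    head-ignores y∈ with ∈-gather⁻ (xs ∘ suc) y∈
    ... | i , y∈i = prodAt-ignores (fs zero) (sep (λ ()) y∈i)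
    tail-ignores : ∀ {x} → x ∈ˡ xs zero → prodAt fs₊ Ignores x
    tail-ignores x∈ = prodAt-ignores fs₊ λ f∈ →
      let j , f∈j = ∈-gather⁻ (fs ∘ suc) f∈ in sep (λ ()) x∈ f∈j

  -- The descendant condition, stated through leaves rather than the inverse of `γ`, since the
  -- labelling of a subtree need not reach all clauses.
  ScopesBelow : ∀ {T} → (Leaf T → Clause n) → (Internal T → Subset n) → Set
  ScopesBelow γ π = ∀ m {x} → x ∈ π m → ∀ l → x ∈ vars (γ l) → l DescendantOf m

  below-scopes : ∀ {k ts} {γ : Leaf (node k ts) → Clause n} {π : Internal (node k ts) → Subset n} →
                 ScopesBelow γ π → ∀ i → ScopesBelow (γ ∘ below i) (π ∘ below i)
  below-scopes s i m x∈ l x∈c with s (below i m) x∈ (below i l) x∈c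
  -- Leaf and node lie in the same child, so only `below` can relate them.
  ... | below d = d

  module _ (W : LiteralWeights) where

    open Factorisation R W

    -- Labels are arbitrary functions so that the induction can descend to subtrees. Every `τ`
    -- matters, because a factor in a subtree may mention variables projected only at an ancestor.
    at-valuation : ∀ T (γ : Leaf T → Clause n) (π : Internal T → Subset n) →
      DisjointLabels π → ScopesBelow γ π →
      ∀ τ → valuation W T γ π at τ ≈ sumOver (projectedVars T π) (prodAt (factors T γ π)) τ
    -- The product over the single factor of a leaf ends in `1#`.
    at-valuation leaf γ π disjoint scopes τ = ≈-sym (*-identityʳ _)
    at-valuation (node k ts) γ π disjoint scopes τ = begin
      valuation W (node k ts) γ π at τ
        ≈⟨ at-projectList ys (∏ (tabulate V) · ∏weight W (π root)) _ _ τ ⟩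
      sumOver ys ((∏ (tabulate V) · ∏weight W (π root)) at_) τ
        ≈⟨ sumOver-cong ys product τ ⟩
      sumOver ys (sumOver (gather xs) (prodAt (factors (node k ts) γ π))) τ
        ≡⟨ cong (λ H → H τ) (foldr-++ sumOut _ ys (gather xs)) ⟨
      sumOver (ys ++ gather xs) (prodAt (factors (node k ts) γ π)) τ ∎
      where
      ys = elements (π root)
      ws = List.map (weight W) ys
      V  = λ i → valuation W (ts i) (γ ∘ below i) (π ∘ below i)
      xs = λ i → projectedVars (ts i) (π ∘ below i)
      fs = λ i → factors (ts i) (γ ∘ below i) (π ∘ below i)

      -- A weight mentioning `x` would put `x` in two different labels. A clause mentioning `x`
      -- would sit at a leaf of child `j` descending from a node of child `i`, forcing `i` and `j`
      -- to be equal.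
      separated : ∀ {i j x f} → i ≢ j → x ∈ˡ xs i → f ∈ˡ fs j → x ∉ dom f
      separated {i} {j} i≢j x∈ f∈ x∈f
        with ∈-projectedVars⁻ (ts i) x∈ | factor-scope (ts j) f∈ x∈f
      ... | m , x∈m | inj₂ (m′ , x∈m′) = disjoint (internal-below-≢ i≢j) x∈m x∈m′
      ... | m , x∈m | inj₁ (l , x∈l) with scopes (below i m) x∈m (below j l) x∈l
      ...   | below _ = i≢j refl

      -- A variable projected in a child lies outside `π root`, and the weights at the root mention
      -- only variables in `π root`. Hence they can enter the children's sums.
      weights-ignore : ∀ {x} → x ∈ˡ gather xs → prodAt ws Ignores x
      weights-ignore x∈ with ∈-gather⁻ xs x∈
      ... | i , x∈i with ∈-projectedVars⁻ (ts i) x∈i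
      ...   | m , x∈m = prodAt-ignores ws λ f∈ x∈f → disjoint (λ ()) x∈m (∈-weights⁻ f∈ x∈f)

      product : ∀ σ → (∏ (tabulate V) · ∏weight W (π root)) at σ
                      ≈ sumOver (gather xs) (prodAt (factors (node k ts) γ π)) σ
      product σ = begin
        (∏ (tabulate V) · ∏weight W (π root)) at σ
          ≡⟨ at-· (∏ (tabulate V)) (∏ ws) σ ⟩
        ∏ (tabulate V) at σ * ∏ ws at σ
          ≡⟨ cong₂ _*_ (at-∏ (tabulate V) σ) (at-∏ ws σ) ⟩
        prodAt (tabulate V) σ * prodAt ws σ
          ≈⟨ *-cong (prodAt-tabulate V xs fs
               (λ i → at-valuation (ts i) (γ ∘ below i) (π ∘ below i)
                        (below-disjoint {π = π} disjoint i) (below-scopes scopes i))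
               separated σ) ≈-refl ⟩
        sumOver (gather xs) (prodAt (gather fs)) σ * prodAt ws σ
          ≈⟨ sumOver-* (gather xs) (prodAt (gather fs)) weights-ignore σ ⟩
        sumOver (gather xs) (λ ρ → prodAt (gather fs) ρ * prodAt ws ρ) σ
          ≈⟨ sumOver-cong (gather xs) (prodAt-++ (gather fs) ws) σ ⟨
        sumOver (gather xs) (prodAt (gather fs ++ ws)) σ ∎

    -- The whole project-join tree.

    module _ {φ : CNF n} (P : ProjectJoinTree φ) where
      open ProjectJoinTree P

      private
        label : Leaf T → Clause n
        label = proj₁ ∘ Inverse.to γ

      -- `ClauseOf` pairs a clause with a membership proof. As the clauses are distinct, that proof
      -- is unique, so `γ` stays injective after the proof is dropped.
      label-injective : ∀ {l l′} → label l ≡ label l′ → l ≡ l′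
      label-injective {l} {l′} eq = trans (sym (Inverse.strictlyInverseʳ γ l))
        (trans (cong (Inverse.from γ) (ClauseOf-≡ eq)) (Inverse.strictlyInverseʳ γ l′))
        where
        ClauseOf-≡ : ∀ {c d : ClauseOf φ} → proj₁ c ≡ proj₁ d → c ≡ d
        ClauseOf-≡ {c , c∈} {_ , c∈′} refl = cong (c ,_) (unique⇒irrelevant (CNF.distinct φ) c∈ c∈′)

      -- Injectivity of the labelling excludes repetitions, and surjectivity makes every clause
      -- occur.
      labels-↭ : leafLabels T label ↭ clauses φ
      labels-↭ = unique-same⇒↭ (leafLabels-unique T label-injective) (CNF.distinct φ) to from
        where
        to : ∀ {c} → c ∈ˡ leafLabels T label → c ∈ˡ clauses φ
        to c∈ with ∈-leafLabels⁻ T c∈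
        ... | l , refl = proj₂ (Inverse.to γ l)
        from : ∀ {c} → c ∈ˡ clauses φ → c ∈ˡ leafLabels T label
        from {c} c∈ = subst (_∈ˡ leafLabels T label)
          (cong proj₁ (Inverse.strictlyInverseˡ γ (c , c∈)))
          (∈-leafLabels⁺ {γ = label} (Inverse.from γ (c , c∈)))

      disjoint : DisjointLabels π
      disjoint m≢m′ x∈ x∈′ = π-disjoint m≢m′ (_ , x∈p∩q⁺ (x∈ , x∈′))

      scopes : ScopesBelow label π
      scopes m x∈ l x∈l = subst (_DescendantOf m) (Inverse.strictlyInverseʳ γ l)
        (π-below m x∈ (Inverse.to γ l) x∈l)

      -- Disjointness of the labels excludes repetitions; `π-covers` supplies every variable.
      projectedVars-↭ : projectedVars T π ↭ allFin n
      projectedVars-↭ = unique-same⇒↭ (projectedVars-unique T disjoint) (Unique.allFin⁺ n)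
        (λ _ → ∈-allFin _)
        (λ {x} _ → let m , x∈ = π-covers x in ∈-projectedVars⁺ {π = π} m x∈)

      rootValuation≈ : fun (rootValuation W P) ∅ ≈ weightedModelCount W φ
      rootValuation≈ = begin
        fun f ∅
          -- `∅` is the restriction of `⊥` to any domain, so `dom f` need not be computed.
          ≡⟨ cong (fun f) (value-injective (∩-zeroˡ (dom f))) ⟨
        f at ⊥
          ≈⟨ at-valuation T label π disjoint scopes ⊥ ⟩
        sumOver (projectedVars T π) (prodAt (factors T label π)) ⊥
          ≈⟨ sumOver-↭ _ projectedVars-↭ ⊥ ⟩
        sumOver (allFin n) (prodAt (factors T label π)) ⊥
          ≈⟨ sumOver-cong (allFin n) summand ⊥ ⟩
        sumOver (allFin n) (λ τ → cnfFunction φ at τ * weightFunction W at τ) ⊥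
          ≈⟨ sumOver-allFin n _ ⊥ ⟩
        weightedModelCount W φ ∎
        where
        f = rootValuation W P
        cs = List.map clauseFunction (clauses φ)
        ws = List.map (weight W) (allFin n)

        summand : ∀ τ → prodAt (factors T label π) τ ≈ cnfFunction φ at τ * weightFunction W at τ
        summand τ = begin
          prodAt (factors T label π) τ
            -- At the root the clauses are exactly those of `φ` and the weights those of all
            -- variables, each once.
            ≈⟨ prodAt-↭ (↭-trans (factors-↭ T label π)
                 (++⁺ (map⁺ clauseFunction labels-↭) (map⁺ (weight W) projectedVars-↭))) τ ⟩
          prodAt (cs ++ ws) τ
            ≈⟨ prodAt-++ cs ws τ ⟩
          prodAt cs τ * prodAt ws τ
            ≡⟨ cong₂ _*_ (at-∏ cs τ) (at-∏ ws τ) ⟨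
          cnfFunction φ at τ * weightFunction W at τ ∎

theorem2 : ∀ {a ℓ} (R : CommutativeRing a ℓ) (n : ℕ) (φ : CNF n) (P : ProjectJoinTree φ)
           (W : PseudoBoolean.LiteralWeights R {n}) →
           let open CommutativeRing R using (_≈_)
               open PseudoBoolean R {n}
           in  fun (rootValuation W P) ∅ ≈ weightedModelCount W φ
theorem2 R n φ P W = Evaluation.rootValuation≈ R W P
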